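{- Let $a,b\ge 1$ and $n$ be integers with $n-a-b\ge 2$, and let $DC(n,a,b)$ be the double comet network of order $n$. Then the agglomeration of $DC(n,a,b)$ is $$\phi(DC(n,a,b))=\frac{3(n-1)}{(n-a-b+1)\big((n-a-b)(n-a+2b-1)+3a(n-a+b)\big)+6\big(b(b-1)+a(a-1)\big)}.$$
   Context: All graphs are finite, simple and undirected. The order of a graph is its number of nodes; $d_{uv}$ denotes the length of a shortest path between nodes $u$ and $v$; a pendent node is a node of degree one. For a connected graph $H$ of order $m\ge 2$, the agglomeration is $$\phi(H)=\frac{m-1}{\sum_{u,v\in V(H),\,u\ne v} d_{uv}},$$ where the sum is over all ordered pairs $(u,v)$ of distinct nodes (equivalently $\phi(H)=1/(mL(H))$, where $L(H)=\frac{1}{m(m-1)}\sum_{u\neq v}d_{uv}$ is the average path length). For $a,b\ge 1$ and $n\ge a+b+2$, the double comet $DC(n,a,b)$ is the tree on $n$ nodes obtained from a path with $n-a-b$ nodes by attaching $a$ pendent nodes to one of the end-nodes of the path and $b$ pendent nodes to the other end-node of the path. -}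

module Defs where

open import Data.Bool.Base using (if_then_else_)
open import Data.Empty using (⊥)
open import Data.Fin.Base using (Fin; zero; suc; toℕ; fromℕ; splitAt; _↑ˡ_)
open import Data.Fin.Properties using (_≟_; any?; splitAt-↑ˡ; splitAt⁻¹-↑ˡ)
open import Data.Integer.Base as ℤ using (+_)
open import Data.Nat.Base using (ℕ; zero; suc; _+_; _∸_; _≤_; z≤n; s≤s; NonZero; >-nonZero; ≢-nonZero)
open import Data.Nat.Properties as ℕ using (+-0-commutativeMonoid)
open import Data.Product.Base using (∃; _×_; _,_; proj₁; proj₂)
open import Data.Rational.Base using (ℚ; _/_)
open import Data.Sum.Base using (_⊎_; inj₁; inj₂; swap)
open import Data.Vec.Base using (Vec; []; _∷_; head; last)
open import Data.Vec.Relation.Unary.All using (All; []; _∷_)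
open import Data.Vec.Relation.Unary.AllPairs using ([]; _∷_; allPairs?)
open import Data.Vec.Relation.Unary.Any using (here; there)
open import Data.Vec.Relation.Unary.Linked using (Linked; [-]; _∷_; linked?)
open import Data.Vec.Relation.Unary.Unique.Propositional using (Unique)
open import Data.Vec.Membership.Propositional using (_∈_; _∉_)
open import Data.Vec.Membership.DecPropositional using (_∈?_)
open import Level using (0ℓ)
open import Relation.Binary.Construct.Closure.ReflexiveTransitive using (Star; ε; _◅_; _◅◅_; gmap; reverse)
open import Relation.Binary.Core using (Rel)
open import Relation.Binary.Definitions using (Symmetric; Irreflexive; Decidable)
open import Relation.Binary.PropositionalEquality using (_≡_; _≢_; refl; sym; trans; cong; subst)
open import Relation.Nullary.Decidable using (Dec; yes; no; ⌊_⌋; map′; ¬?; _×-dec_; _⊎-dec_)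
open import Relation.Nullary.Negation using (¬_; contradiction)
open import Relation.Unary as U using (Pred)

open import Algebra.Properties.CommutativeMonoid.Sum +-0-commutativeMonoid using (sum-syntax)

record Graph : Set₁ where
  field
    order  : ℕ
    Adj    : Rel (Fin order) 0ℓ
    symm   : Symmetric Adj
    irrefl : Irreflexive _≡_ Adj
    adj?   : Decidable Adj

  Node : Set
  Node = Fin order

open Graph using (order; Node)

module _ (G : Graph) where
  open Graph G using (Adj; symm; irrefl; adj?)

  record IsPath (u v : Node G) {k} (xs : Vec (Node G) (suc k)) : Set where
    constructor isPath
    field
      starts   : head xs ≡ u
      ends     : last xs ≡ v
      linked   : Linked Adj xs
      distinct : Unique xs

  -- k counts edges, so a path of length k has k + 1 nodes.
  Path : Node G → Node G → ℕ → Set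
  Path u v k = ∃ λ (xs : Vec (Node G) (suc k)) → IsPath u v xs

  Connected : Set
  Connected = ∀ u v → ∃ (Path u v)

anyVec? : ∀ {m} k {P : Pred (Vec (Fin m) k) 0ℓ} → U.Decidable P → Dec (∃ P)
anyVec? zero    P? = map′ ([] ,_) (λ { ([] , p) → p }) (P? [])
anyVec? (suc k) P? =
  map′ (λ (x , xs , p) → x ∷ xs , p) (λ { (x ∷ xs , p) → x , xs , p })
       (any? λ x → anyVec? k λ xs → P? (x ∷ xs))

path? : ∀ G u v → U.Decidable (Path G u v)
path? G u v k = anyVec? (suc k) λ xs →
  map′ (λ (s , e , l , d) → isPath s e l d)
       (λ (isPath s e l d) → s , e , l , d)
       (head xs ≟ u ×-dec last xs ≟ v ×-dec linked? (Graph.adj? G) xs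
         ×-dec allPairs? (λ x y → ¬? (x ≟ y)) xs)

IsLeast : Pred ℕ 0ℓ → ℕ → Set
IsLeast P k = P k × (∀ {j} → P j → k ≤ j)

least : ∀ {P : Pred ℕ 0ℓ} → U.Decidable P → ∀ k → P k → ∃ (IsLeast P)
least P? zero p = zero , p , λ _ → z≤n
least {P} P? (suc k) p with P? zero
... | yes p₀ = zero , p₀ , λ _ → z≤n
... | no ¬p₀ with least {λ j → P (suc j)} (λ j → P? (suc j)) k p
...   | j , q , min = suc j , q ,
        λ { {zero} p₀ → contradiction p₀ ¬p₀ ; {suc _} r → s≤s (min r) }

module _ (G : Graph) (conn : Connected G) where

  shortest : ∀ u v → ∃ (IsLeast (Path G u v))
  shortest u v = least (path? G u v) (proj₁ (conn u v)) (proj₂ (conn u v))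

  dist : Node G → Node G → ℕ
  dist u v = proj₁ (shortest u v)

  totalDist : ℕ
  totalDist = ∑[ u < order G ] ∑[ v < order G ] (if ⌊ u ≟ v ⌋ then 0 else dist u v)

dist≢0 : ∀ G (conn : Connected G) {u v} → u ≢ v → dist G conn u v ≢ 0
dist≢0 G conn {u} {v} u≢v with shortest G conn u v
... | zero  , (x ∷ [] , isPath s e _ _) , _ = λ _ → u≢v (trans (sym s) e)
... | suc _ , _                         , _ = λ ()

∑≡0⇒≡0 : ∀ {m} (f : Fin m → ℕ) → ∑[ i < m ] f i ≡ 0 → ∀ i → f i ≡ 0
∑≡0⇒≡0 f eq zero    = ℕ.m+n≡0⇒m≡0 _ eq
∑≡0⇒≡0 f eq (suc i) = ∑≡0⇒≡0 (λ j → f (suc j)) (ℕ.m+n≡0⇒n≡0 (f zero) eq) i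

distinctNodes : ∀ {m} → 2 ≤ m → ∃ λ (i : Fin m) → ∃ λ j → i ≢ j
distinctNodes (s≤s (s≤s _)) = zero , suc zero , λ ()

totalDist-nonZero : ∀ G (conn : Connected G) → 2 ≤ order G → NonZero (totalDist G conn)
totalDist-nonZero G conn 2≤m = ≢-nonZero λ eq →
  let u , v , u≢v = distinctNodes 2≤m
      term≡0 = ∑≡0⇒≡0 _ (∑≡0⇒≡0 _ eq u) v
  in lemma u v u≢v term≡0
  where
  lemma : ∀ u v → u ≢ v → ¬ (if ⌊ u ≟ v ⌋ then 0 else dist G conn u v) ≡ 0
  lemma u v u≢v with u ≟ v
  ... | yes u≡v = contradiction u≡v u≢v
  ... | no  _   = dist≢0 G conn u≢v

agglomeration : ∀ G → Connected G → 2 ≤ order G → ℚ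
agglomeration G conn 2≤m = _/_ (+ order G ℤ.- + 1) (totalDist G conn) {{totalDist-nonZero G conn 2≤m}}

pathGraph : ℕ → Graph
pathGraph p = record
  { order  = p
  ; Adj    = λ i j → toℕ j ≡ suc (toℕ i) ⊎ toℕ i ≡ suc (toℕ j)
  ; symm   = swap
  ; irrefl = λ { refl (inj₁ eq) → ℕ.1+n≢n (sym eq)
               ; refl (inj₂ eq) → ℕ.1+n≢n (sym eq) }
  ; adj?   = λ i j → (toℕ j ℕ.≟ suc (toℕ i)) ⊎-dec (toℕ i ℕ.≟ suc (toℕ j))
  }

-- attach G u k adds k new nodes to G, each adjacent to u and to nothing else.
module _ (G : Graph) (u : Node G) (k : ℕ) where
  open Graph G using (Adj; symm; irrefl; adj?)

  AttachAdj : Rel (Node G ⊎ Fin k) 0ℓ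
  AttachAdj (inj₁ x) (inj₁ y) = Adj x y
  AttachAdj (inj₁ x) (inj₂ _) = x ≡ u
  AttachAdj (inj₂ _) (inj₁ y) = y ≡ u
  AttachAdj (inj₂ _) (inj₂ _) = ⊥

  attach : Graph
  attach = record
    { order  = order G + k
    ; Adj    = λ x y → AttachAdj (splitAt (order G) x) (splitAt (order G) y)
    ; symm   = λ {x} {y} → sym′ (splitAt (order G) x) (splitAt (order G) y)
    ; irrefl = λ { {x} refl → irr′ (splitAt (order G) x) }
    ; adj?   = λ x y → dec′ (splitAt (order G) x) (splitAt (order G) y)
    }
    where
    sym′ : ∀ x y → AttachAdj x y → AttachAdj y x
    sym′ (inj₁ _) (inj₁ _) = symm
    sym′ (inj₁ _) (inj₂ _) eq = eq
    sym′ (inj₂ _) (inj₁ _) eq = eq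

    irr′ : ∀ x → ¬ AttachAdj x x
    irr′ (inj₁ _) = irrefl refl

    dec′ : Decidable AttachAdj
    dec′ (inj₁ x) (inj₁ y) = adj? x y
    dec′ (inj₁ x) (inj₂ _) = x ≟ u
    dec′ (inj₂ _) (inj₁ y) = y ≟ u
    dec′ (inj₂ _) (inj₂ _) = no λ ()

-- For p = 1 the two end-nodes of the path coincide.
doubleCometOnPath : ∀ p .{{_ : NonZero p}} → ℕ → ℕ → Graph
doubleCometOnPath (suc p) a b = attach (attach (pathGraph (suc p)) zero a) (fromℕ p ↑ˡ a) b

pathPart-nonZero : ∀ n a b → a + b + 2 ≤ n → NonZero (n ∸ (a + b))
pathPart-nonZero n a b h = >-nonZero (ℕ.m<n⇒0<n∸m (ℕ.≤-trans (ℕ.m<m+n (a + b) (s≤s z≤n)) h))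

DC : ∀ n a b → a + b + 2 ≤ n → Graph
DC n a b h = doubleCometOnPath (n ∸ (a + b)) {{pathPart-nonZero n a b h}} a b

DC-order : ∀ n a b h → order (DC n a b h) ≡ n
DC-order n a b h = trans (go (n ∸ (a + b)) {{pathPart-nonZero n a b h}})
  (ℕ.m∸n+n≡m (ℕ.≤-trans (ℕ.m≤m+n (a + b) 2) h))
  where
  go : ∀ p .{{_ : NonZero p}} → order (doubleCometOnPath p a b) ≡ p + (a + b)
  go (suc p) = cong suc (ℕ.+-assoc p a b)

2≤DC-order : ∀ n a b h → 2 ≤ order (DC n a b h)
2≤DC-order n a b h = subst (2 ≤_) (sym (DC-order n a b h)) (ℕ.≤-trans (ℕ.m≤n+m 2 (a + b)) h)

-- Connectedness is proved for walks (Star Adj); removing repeated nodes then gives paths.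
module _ (G : Graph) where
  open Graph G using (Adj)

  suffixFrom : ∀ {x y v k} {xs : Vec (Node G) (suc k)} → IsPath G y v xs → x ∈ xs → ∃ (Path G x v)
  suffixFrom {xs = _ ∷ _} (isPath _ e l d) (here refl) = _ , _ , isPath refl e l d
  suffixFrom {xs = _ ∷ _ ∷ _} (isPath _ e (_ ∷ l) (_ ∷ d)) (there x∈) =
    suffixFrom (isPath refl e l d) x∈

  ∉⇒All≢ : ∀ {x k} (xs : Vec (Node G) k) → x ∉ xs → All (x ≢_) xs
  ∉⇒All≢ []       _  = []
  ∉⇒All≢ (y ∷ xs) x∉ = (λ x≡y → x∉ (here x≡y)) ∷ ∉⇒All≢ xs (λ x∈ → x∉ (there x∈))

  walk⇒path : ∀ {u v} → Star Adj u v → ∃ (Path G u v)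
  walk⇒path {u} ε = 0 , u ∷ [] , isPath refl refl [-] ([] ∷ [])
  walk⇒path {u} (uw ◅ walk) with walk⇒path walk
  ... | k , xs@(_ ∷ _) , π@(isPath refl e l d) with _∈?_ _≟_ u xs
  ...   | yes u∈ = suffixFrom π u∈
  ...   | no  u∉ = suc k , u ∷ xs , isPath refl e (uw ∷ l) (∉⇒All≢ xs u∉ ∷ d)

  WalksTo : Node G → Set
  WalksTo r = ∀ x → Star Adj x r

  walksTo⇒connected : ∀ {r} → WalksTo r → Connected G
  walksTo⇒connected to u v = walk⇒path (to u ◅◅ reverse (Graph.symm G) (to v))

pathGraph-walksTo-zero : ∀ p → WalksTo (pathGraph (suc p)) zero
pathGraph-walksTo-zero p zero = ε
pathGraph-walksTo-zero (suc p) (suc i) =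
  gmap suc (λ { (inj₁ eq) → inj₁ (cong suc eq) ; (inj₂ eq) → inj₂ (cong suc eq) })
    (pathGraph-walksTo-zero p i)
  ◅◅ inj₂ refl ◅ ε

attach-walksTo : ∀ G u k r → WalksTo G r → WalksTo (attach G u k) (r ↑ˡ k)
attach-walksTo G u k r to x = walk (splitAt (order G) x) refl
  where
  lift : ∀ {v w} → Graph.Adj G v w → Graph.Adj (attach G u k) (v ↑ˡ k) (w ↑ˡ k)
  lift {v} {w} vw rewrite splitAt-↑ˡ (order G) v k | splitAt-↑ˡ (order G) w k = vw

  old : ∀ y → Star (Graph.Adj (attach G u k)) (y ↑ˡ k) (r ↑ˡ k)
  old y = gmap (_↑ˡ k) lift (to y)

  step : ∀ {j} → splitAt (order G) x ≡ inj₂ j → Graph.Adj (attach G u k) x (u ↑ˡ k)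
  step eq rewrite eq | splitAt-↑ˡ (order G) u k = refl

  walk : ∀ s → splitAt (order G) x ≡ s → Star (Graph.Adj (attach G u k)) x (r ↑ˡ k)
  walk (inj₁ y) eq =
    subst (λ z → Star (Graph.Adj (attach G u k)) z (r ↑ˡ k)) (splitAt⁻¹-↑ˡ eq) (old y)
  walk (inj₂ j) eq = step eq ◅ old u

DC-connected : ∀ n a b h → Connected (DC n a b h)
DC-connected n a b h = go (n ∸ (a + b)) {{pathPart-nonZero n a b h}}
  where
  go : ∀ p .{{_ : NonZero p}} → Connected (doubleCometOnPath p a b)
  go (suc p) = walksTo⇒connected _
    (attach-walksTo _ _ b _ (attach-walksTo _ _ a _ (pathGraph-walksTo-zero p)))

{-# OPTIONS --safe #-}
-- The distance is characterised locally: the 1-Lipschitz law bounds every path from below, and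
-- descending along ever closer neighbours produces a path of exactly that length, whose nodes are
-- distinct because D strictly decreases. Attaching leaves extends such a D explicitly, so the sum
-- of distances is tracked through the two attachments, starting from ∣ i - j ∣ on the path.

module Submission where

open import Defs
open import Data.Bool.Base using (if_then_else_)
open import Data.Fin.Base using (Fin; zero; suc; toℕ; fromℕ; inject₁; splitAt; join; _↑ˡ_)
open import Data.Fin.Properties as Fin
  using (toℕ-fromℕ; toℕ-inject₁; toℕ-injective; splitAt-↑ˡ; splitAt-join; join-splitAt)
open import Data.Integer.Base using (+_; _+_; _-_; _*_)
import Data.Integer.Properties as ℤ
open import Data.Integer.Tactic.RingSolver using () renaming (solve-∀ to ℤ-solve-∀)
open import Data.Nat.Base as ℕ using (ℕ; zero; suc; _≤_; z≤n; s≤s; ∣_-_∣)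
import Data.Nat.Properties as ℕ
open import Data.Nat.Tactic.RingSolver using (solve-∀)
open import Data.Product.Base using (Σ; ∃; _×_; _,_; proj₁; proj₂)
import Data.Rational.Base as ℚ
open import Data.Rational.Base using (NonZero; _/_; _÷_)
import Data.Rational.Properties as ℚ
open import Data.Rational.Unnormalised.Base as ℚᵘ using (mkℚᵘ; *≡*)
import Data.Rational.Unnormalised.Properties as ℚᵘ
open import Data.Sum.Base using (_⊎_; inj₁; inj₂; map₁)
open import Data.Vec.Base using (Vec; _∷_; [])
open import Data.Vec.Relation.Unary.All as All using (All; []; _∷_)
open import Data.Vec.Relation.Unary.AllPairs using ([]; _∷_)
open import Data.Vec.Relation.Unary.Linked using ([-]; _∷_)
open import Function.Base using (_∘_)
open import Relation.Binary.PropositionalEquality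
  using (_≡_; _≢_; refl; sym; trans; cong; cong₂; subst; module ≡-Reasoning)
open import Relation.Nullary.Decidable using (yes; no; ⌊_⌋)

open import Algebra.Properties.CommutativeMonoid.Sum ℕ.+-0-commutativeMonoid
  using (sum-syntax; sum-cong-≗; ∑-distrib-+)
open import Algebra.Properties.Semiring.Sum ℕ.+-*-semiring using (*-distribˡ-sum)

open Graph using (order; Node; Adj)

-- Local laws that determine the distance function of a graph.

-- No law involves more than one edge, so for a graph with attached leaves each can be checked by
-- cases on the kinds of nodes, without handling paths.
record IsDistance (G : Graph) (D : Node G → Node G → ℕ) : Set where
  field
    D-refl   : ∀ u → D u u ≡ 0
    D-sym    : ∀ u v → D u v ≡ D v u
    D≡0⇒≡    : ∀ {u v} → D u v ≡ 0 → u ≡ v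
    D-step   : ∀ {u w} v → Adj G u w → D u v ≤ suc (D w v)
    D-closer : ∀ {u v k} → D u v ≡ suc k → ∃ λ w → Adj G u w × D w v ≡ k

module _ {G : Graph} {D : Node G → Node G → ℕ} (isDistance : IsDistance G D) where
  open IsDistance isDistance

  D≤length : ∀ {u v k} → Path G u v k → D u v ≤ k
  D≤length (_ ∷ [] , isPath refl refl _ _) = ℕ.≤-reflexive (D-refl _)
  D≤length (_ ∷ y ∷ xs , isPath refl e (xy ∷ l) (_ ∷ d)) =
    ℕ.≤-trans (D-step _ xy) (s≤s (D≤length (y ∷ xs , isPath refl e l d)))

  -- The bound on all nodes strengthens the induction: the new head has value `suc k`, above that of
  -- every later node, and this yields the inequalities that `Unique` asks of it.
  descent : ∀ k {u v} → D u v ≡ k →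
            ∃ λ (xs : Vec (Node G) (suc k)) → IsPath G u v xs × All (λ x → D x v ≤ k) xs
  descent zero eq with D≡0⇒≡ eq
  ... | refl = _ ∷ [] , isPath refl refl [-] ([] ∷ []) , ℕ.≤-reflexive eq ∷ []
  descent (suc k) {u} {v} eq with D-closer eq
  ... | w , uw , eq′ with descent k eq′
  ... | xs@(_ ∷ _) , isPath refl e l d , bound =
    u ∷ xs
    , isPath refl e (uw ∷ l) (All.map u≢ bound ∷ d)
    , ℕ.≤-reflexive eq ∷ All.map ℕ.m≤n⇒m≤1+n bound
    where
    u≢ : ∀ {x} → D x v ≤ k → u ≢ x
    u≢ D≤k refl = ℕ.1+n≰n (subst (_≤ k) eq D≤k)

  dist≡D : ∀ conn u v → dist G conn u v ≡ D u v
  dist≡D conn u v with shortest G conn u v | descent (D u v) refl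
  ... | _ , path , minimal | xs , isPath′ , _ =
    ℕ.≤-antisym (minimal (xs , isPath′)) (D≤length path)

  totalDist≡ : ∀ conn → totalDist G conn ≡ ∑[ u < order G ] ∑[ v < order G ] D u v
  totalDist≡ conn = sum-cong-≗ λ u → sum-cong-≗ λ v → term u v
    where
    term : ∀ u v → (if ⌊ u Fin.≟ v ⌋ then 0 else dist G conn u v) ≡ D u v
    term u v with u Fin.≟ v
    -- `totalDist` puts 0 on the diagonal; `D` vanishes there as well, so the case split disappears
    -- from the sum.
    ... | yes refl = sym (D-refl u)
    ... | no _     = dist≡D conn u v

-- Distance on the path.

pathDist : ∀ {p} → Fin p → Fin p → ℕ
pathDist i j = ∣ toℕ i - toℕ j ∣

-- The witness is the neighbour of `i` on the side of `j`. If both are positive, lowering both by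
-- one changes neither distance nor adjacency.
pathDist-closer : ∀ {p k} (i j : Fin p) → pathDist i j ≡ suc k →
                  ∃ λ w → Adj (pathGraph p) i w × pathDist w j ≡ k
pathDist-closer zero    (suc {suc _} j) refl = suc zero , inj₁ refl , refl
pathDist-closer (suc i) zero    refl =
  inject₁ i , inj₂ (cong suc (sym (toℕ-inject₁ i)))
  , trans (ℕ.∣-∣-identityʳ _) (toℕ-inject₁ i)
pathDist-closer (suc i) (suc j) eq with pathDist-closer i j eq
... | w , inj₁ iw , eq′ = suc w , inj₁ (cong suc iw) , eq′
... | w , inj₂ iw , eq′ = suc w , inj₂ (cong suc iw) , eq′

∣n-1+n∣≡1 : ∀ n → ∣ n - suc n ∣ ≡ 1
∣n-1+n∣≡1 zero    = refl
∣n-1+n∣≡1 (suc n) = ∣n-1+n∣≡1 n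

pathDist-isDistance : ∀ p → IsDistance (pathGraph p) pathDist
pathDist-isDistance p = record
  { D-refl   = λ u → ℕ.∣n-n∣≡0 (toℕ u)
  ; D-sym    = λ u v → ℕ.∣-∣-comm (toℕ u) (toℕ v)
  ; D≡0⇒≡    = λ eq → toℕ-injective (ℕ.∣m-n∣≡0⇒m≡n eq)
  ; D-step   = step
  ; D-closer = λ eq → pathDist-closer _ _ eq
  }
  where
  adj⇒1 : ∀ u w → Adj (pathGraph p) u w → pathDist u w ≡ 1
  adj⇒1 u w (inj₁ eq) rewrite eq = ∣n-1+n∣≡1 (toℕ u)
  adj⇒1 u w (inj₂ eq) rewrite eq = trans (ℕ.∣-∣-comm (suc (toℕ w)) (toℕ w)) (∣n-1+n∣≡1 (toℕ w))

  step : ∀ {u w} v → Adj (pathGraph p) u w → pathDist u v ≤ suc (pathDist w v)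
  step {u} {w} v uw = ℕ.≤-trans (ℕ.∣-∣-triangle (toℕ u) (toℕ w) (toℕ v))
    (ℕ.≤-reflexive (cong (ℕ._+ pathDist w v) (adj⇒1 u w uw)))

-- Distance after attaching leaves to a node.

-- Recursion on both indices, instead of an equality test, makes the double sum over `suc k` leaves
-- unfold to the one over `k` leaves.
siblingDist : ∀ {k} → Fin k → Fin k → ℕ
siblingDist zero    zero    = 0
siblingDist zero    (suc _) = 2
siblingDist (suc _) zero    = 2
siblingDist (suc i) (suc j) = siblingDist i j

siblingDist-refl : ∀ {k} (i : Fin k) → siblingDist i i ≡ 0
siblingDist-refl zero    = refl
siblingDist-refl (suc i) = siblingDist-refl i

siblingDist-sym : ∀ {k} (i j : Fin k) → siblingDist i j ≡ siblingDist j i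
siblingDist-sym zero    zero    = refl
siblingDist-sym zero    (suc _) = refl
siblingDist-sym (suc _) zero    = refl
siblingDist-sym (suc i) (suc j) = siblingDist-sym i j

siblingDist-cases : ∀ {k} (i j : Fin k) → i ≡ j ⊎ siblingDist i j ≡ 2
siblingDist-cases zero    zero    = inj₁ refl
siblingDist-cases zero    (suc _) = inj₂ refl
siblingDist-cases (suc _) zero    = inj₂ refl
siblingDist-cases (suc i) (suc j) = map₁ (cong suc) (siblingDist-cases i j)

siblingDist≤2 : ∀ {k} (i j : Fin k) → siblingDist i j ≤ 2
siblingDist≤2 i j with siblingDist-cases i j
... | inj₁ refl = ℕ.≤-trans (ℕ.≤-reflexive (siblingDist-refl i)) z≤n
... | inj₂ eq   = ℕ.≤-reflexive eq

module _ (G : Graph) (u : Node G) (k : ℕ) (D : Node G → Node G → ℕ) where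

  -- A leaf is reached only through `u`, which costs one extra edge and creates no shortcut between
  -- old nodes. Working on the disjoint union lets the laws be proved by cases before `splitAt`
  -- transports them.
  attachDist⊎ : Node G ⊎ Fin k → Node G ⊎ Fin k → ℕ
  attachDist⊎ (inj₁ x) (inj₁ y) = D x y
  attachDist⊎ (inj₁ x) (inj₂ _) = suc (D x u)
  attachDist⊎ (inj₂ _) (inj₁ y) = suc (D u y)
  attachDist⊎ (inj₂ i) (inj₂ j) = siblingDist i j

  attachDist : Node (attach G u k) → Node (attach G u k) → ℕ
  attachDist x y = attachDist⊎ (splitAt (order G) x) (splitAt (order G) y)

  module _ (isDistance : IsDistance G D) where
    open IsDistance isDistance

    private
      E = attachDist⊎

      E-refl : ∀ x → E x x ≡ 0
      E-refl (inj₁ x) = D-refl x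
      E-refl (inj₂ i) = siblingDist-refl i

      E-sym : ∀ x y → E x y ≡ E y x
      E-sym (inj₁ x) (inj₁ y) = D-sym x y
      E-sym (inj₁ x) (inj₂ _) = cong suc (D-sym x u)
      E-sym (inj₂ _) (inj₁ y) = cong suc (D-sym u y)
      E-sym (inj₂ i) (inj₂ j) = siblingDist-sym i j

      E≡0⇒≡ : ∀ x y → E x y ≡ 0 → x ≡ y
      E≡0⇒≡ (inj₁ _) (inj₁ _) eq = cong inj₁ (D≡0⇒≡ eq)
      E≡0⇒≡ (inj₂ i) (inj₂ j) eq with siblingDist-cases i j
      ... | inj₁ i≡j = cong inj₂ i≡j
      ... | inj₂ eq₂ with () ← trans (sym eq) eq₂

      E-step : ∀ x w y → AttachAdj G u k x w → E x y ≤ suc (E w y)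
      E-step (inj₁ x) (inj₁ w) (inj₁ y) xw   = D-step y xw
      E-step (inj₁ x) (inj₁ w) (inj₂ j) xw   = s≤s (D-step u xw)
      E-step (inj₁ x) (inj₂ i) (inj₁ y) refl = ℕ.≤-trans (ℕ.n≤1+n _) (ℕ.n≤1+n _)
      E-step (inj₁ x) (inj₂ i) (inj₂ j) refl = s≤s (ℕ.≤-trans (ℕ.≤-reflexive (D-refl u)) z≤n)
      E-step (inj₂ i) (inj₁ w) (inj₁ y) refl = ℕ.≤-refl
      E-step (inj₂ i) (inj₁ w) (inj₂ j) refl = ℕ.≤-trans (siblingDist≤2 i j) (s≤s (s≤s z≤n))

      E-closer : ∀ x y {l} → E x y ≡ suc l → ∃ λ w → AttachAdj G u k x w × E w y ≡ l
      E-closer (inj₁ x) (inj₁ y) eq with D-closer eq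
      ... | w , xw , eq′ = inj₁ w , xw , eq′
      -- If `D x u` is 0, then `x` is `u` and the next node is the leaf itself; otherwise the walk
      -- first approaches `u` inside `G`.
      E-closer (inj₁ x) (inj₂ j) {zero}  eq = inj₂ j , D≡0⇒≡ (ℕ.suc-injective eq) , siblingDist-refl j
      E-closer (inj₁ x) (inj₂ j) {suc l} eq with D-closer (ℕ.suc-injective eq)
      ... | w , xw , eq′ = inj₁ w , xw , cong suc eq′
      E-closer (inj₂ i) (inj₁ y) eq = inj₁ u , refl , ℕ.suc-injective eq
      E-closer (inj₂ i) (inj₂ j) eq with siblingDist-cases i j
      ... | inj₁ refl with () ← trans (sym eq) (siblingDist-refl i)
      ... | inj₂ eq₂ = inj₁ u , refl , trans (cong suc (D-refl u)) (ℕ.suc-injective (trans (sym eq₂) eq))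

    attachDist-isDistance : IsDistance (attach G u k) attachDist
    attachDist-isDistance = record
      { D-refl   = λ x → E-refl (split x)
      ; D-sym    = λ x y → E-sym (split x) (split y)
      -- `splitAt` is injective because `join` inverts it.
      ; D≡0⇒≡    = λ {x} {y} eq → begin
          x                    ≡⟨ join-splitAt m k x ⟨
          join m k (split x)   ≡⟨ cong (join m k) (E≡0⇒≡ (split x) (split y) eq) ⟩
          join m k (split y)   ≡⟨ join-splitAt m k y ⟩
          y                    ∎
      ; D-step   = λ {x} {w} y → E-step (split x) (split w) (split y)
      ; D-closer = λ {x} {y} eq →
          let w , xw , eq′ = E-closer (split x) (split y) eq
              w≡ = sym (splitAt-join m k w)
          in join m k w , subst (AttachAdj G u k (split x)) w≡ xw
             , trans (cong (λ z → E z (split y)) (sym w≡)) eq′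
      }
      where
      open ≡-Reasoning
      m = order G
      split = splitAt m

-- Finite sums, and the effect of attached leaves on distance sums.

∑-const : ∀ m c → ∑[ i < m ] c ≡ m ℕ.* c
∑-const zero    c = refl
∑-const (suc m) c = cong (c ℕ.+_) (∑-const m c)

∑-suc : ∀ {m} (f : Fin m → ℕ) → ∑[ i < m ] suc (f i) ≡ m ℕ.+ ∑[ i < m ] f i
∑-suc {m} f = trans (∑-distrib-+ (λ _ → 1) f)
  (cong (ℕ._+ ∑[ i < m ] f i) (trans (∑-const m 1) (ℕ.*-identityʳ m)))

∑-splitAt : ∀ m {k} (f : Fin m ⊎ Fin k → ℕ) →
            ∑[ x < m ℕ.+ k ] f (splitAt m x) ≡ ∑[ i < m ] f (inj₁ i) ℕ.+ ∑[ j < k ] f (inj₂ j)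
∑-splitAt zero    f = refl
-- On a successor, `splitAt (suc m)` wraps the smaller result in `map₁ suc`; hence the composite in
-- the induction.
∑-splitAt (suc m) f = trans (cong (f (inj₁ zero) ℕ.+_) (∑-splitAt m (f ∘ map₁ suc)))
  (sym (ℕ.+-assoc (f (inj₁ zero)) _ _))

distSum : ∀ {m} → (Fin m → Fin m → ℕ) → Fin m → ℕ
distSum {m} D v = ∑[ x < m ] D x v

distTotal : ∀ {m} → (Fin m → Fin m → ℕ) → ℕ
distTotal {m} D = ∑[ x < m ] ∑[ y < m ] D x y

-- There are `k * (k - 1)` ordered pairs of distinct leaves, each at distance 2; the term `2 * k` is
-- moved to the left to avoid subtraction. In the induction the first leaf adds a row and a column
-- of `k` twos.
distTotal-siblingDist : ∀ k → distTotal (siblingDist {k}) ℕ.+ 2 ℕ.* k ≡ 2 ℕ.* (k ℕ.* k)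
distTotal-siblingDist zero    = refl
distTotal-siblingDist (suc k) = begin
  (∑[ j < k ] 2) ℕ.+ (∑[ i < k ] (2 ℕ.+ ∑[ j < k ] siblingDist i j)) ℕ.+ 2 ℕ.* suc k
    ≡⟨ cong (λ s → (∑[ j < k ] 2) ℕ.+ s ℕ.+ 2 ℕ.* suc k)
            (∑-distrib-+ (λ _ → 2) (λ i → ∑[ j < k ] siblingDist i j)) ⟩
  (∑[ j < k ] 2) ℕ.+ ((∑[ j < k ] 2) ℕ.+ L) ℕ.+ 2 ℕ.* suc k
    ≡⟨ cong (λ s → s ℕ.+ (s ℕ.+ L) ℕ.+ 2 ℕ.* suc k) (∑-const k 2) ⟩
  k ℕ.* 2 ℕ.+ (k ℕ.* 2 ℕ.+ L) ℕ.+ 2 ℕ.* suc k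
    ≡⟨ regroup k L ⟩
  (L ℕ.+ 2 ℕ.* k) ℕ.+ (4 ℕ.* k ℕ.+ 2)
    ≡⟨ cong (ℕ._+ (4 ℕ.* k ℕ.+ 2)) (distTotal-siblingDist k) ⟩
  2 ℕ.* (k ℕ.* k) ℕ.+ (4 ℕ.* k ℕ.+ 2)
    ≡⟨ square k ⟩
  2 ℕ.* (suc k ℕ.* suc k) ∎
  where
  open ≡-Reasoning
  L = distTotal (siblingDist {k})
  regroup : ∀ k L → k ℕ.* 2 ℕ.+ (k ℕ.* 2 ℕ.+ L) ℕ.+ 2 ℕ.* suc k ≡ (L ℕ.+ 2 ℕ.* k) ℕ.+ (4 ℕ.* k ℕ.+ 2)
  regroup = solve-∀
  square : ∀ k → 2 ℕ.* (k ℕ.* k) ℕ.+ (4 ℕ.* k ℕ.+ 2) ≡ 2 ℕ.* (suc k ℕ.* suc k)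
  square = solve-∀

module _ (G : Graph) (u : Node G) (k : ℕ) (D : Node G → Node G → ℕ) where
  private
    m = order G
    E = attachDist⊎ G u k D
    open ≡-Reasoning

  -- Needed at the far end of the path, where the second group of leaves is attached after the
  -- first.
  distSum-attachDist : ∀ v → distSum (attachDist G u k D) (v ↑ˡ k) ≡ distSum D v ℕ.+ k ℕ.* suc (D u v)
  distSum-attachDist v = begin
    ∑[ x < m ℕ.+ k ] E (splitAt m x) (splitAt m (v ↑ˡ k))
      ≡⟨ sum-cong-≗ (λ x → cong (E (splitAt m x)) (splitAt-↑ˡ m v k)) ⟩
    ∑[ x < m ℕ.+ k ] E (splitAt m x) (inj₁ v)
      ≡⟨ ∑-splitAt m {k} (λ x → E x (inj₁ v)) ⟩
    distSum D v ℕ.+ ∑[ j < k ] suc (D u v)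
      ≡⟨ cong (distSum D v ℕ.+_) (∑-const k _) ⟩
    distSum D v ℕ.+ k ℕ.* suc (D u v) ∎

  -- The matrix of distances splits into four blocks. The two mixed ones have the same sum `C`,
  -- since each leaf is one step further than `u` from each of the `m` old nodes.
  distTotal-attachDist : (∀ x y → D x y ≡ D y x) →
    distTotal (attachDist G u k D)
      ≡ distTotal D ℕ.+ 2 ℕ.* (k ℕ.* (m ℕ.+ distSum D u)) ℕ.+ distTotal (siblingDist {k})
  distTotal-attachDist D-sym = begin
    ∑[ x < m ℕ.+ k ] ∑[ y < m ℕ.+ k ] E (splitAt m x) (splitAt m y)
      ≡⟨ sum-cong-≗ (λ x → ∑-splitAt m {k} (E (splitAt m x))) ⟩
    ∑[ x < m ℕ.+ k ] row (splitAt m x)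
      ≡⟨ ∑-splitAt m {k} row ⟩
    (∑[ x < m ] (∑[ y < m ] D x y ℕ.+ ∑[ j < k ] suc (D x u)))
      ℕ.+ (∑[ i < k ] ((∑[ y < m ] suc (D u y)) ℕ.+ ∑[ j < k ] siblingDist i j))
      ≡⟨ cong₂ ℕ._+_ (∑-distrib-+ _ (λ x → ∑[ j < k ] suc (D x u)))
                     (∑-distrib-+ {k} (λ _ → ∑[ y < m ] suc (D u y)) _) ⟩
    distTotal D ℕ.+ (∑[ x < m ] ∑[ j < k ] suc (D x u))
      ℕ.+ ((∑[ i < k ] ∑[ y < m ] suc (D u y)) ℕ.+ L)
      ≡⟨ cong₂ (λ s t → distTotal D ℕ.+ s ℕ.+ (t ℕ.+ L)) old-new new-old ⟩
    distTotal D ℕ.+ C ℕ.+ (C ℕ.+ L)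
      ≡⟨ regroup (distTotal D) C L ⟩
    distTotal D ℕ.+ 2 ℕ.* C ℕ.+ L ∎
    where
    L = distTotal (siblingDist {k})
    C = k ℕ.* (m ℕ.+ distSum D u)

    row : Node G ⊎ Fin k → ℕ
    row x = ∑[ y < m ] E x (inj₁ y) ℕ.+ ∑[ j < k ] E x (inj₂ j)

    old-new : ∑[ x < m ] ∑[ j < k ] suc (D x u) ≡ C
    old-new = begin
      ∑[ x < m ] ∑[ j < k ] suc (D x u) ≡⟨ sum-cong-≗ {m} (λ x → ∑-const k _) ⟩
      ∑[ x < m ] (k ℕ.* suc (D x u))    ≡⟨ *-distribˡ-sum k (λ x → suc (D x u)) ⟨
      k ℕ.* ∑[ x < m ] suc (D x u)      ≡⟨ cong (k ℕ.*_) (∑-suc (λ x → D x u)) ⟩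
      C                                 ∎

    new-old : ∑[ i < k ] ∑[ y < m ] suc (D u y) ≡ C
    new-old = begin
      ∑[ i < k ] ∑[ y < m ] suc (D u y) ≡⟨ ∑-const k _ ⟩
      -- `distSum` runs over the first argument of `D`, so this block has to be reflected.
      k ℕ.* ∑[ y < m ] suc (D u y)      ≡⟨ cong (k ℕ.*_) (sum-cong-≗ λ y → cong suc (D-sym u y)) ⟩
      k ℕ.* ∑[ y < m ] suc (D y u)      ≡⟨ cong (k ℕ.*_) (∑-suc (λ y → D y u)) ⟩
      C                                 ∎

    regroup : ∀ t c l → t ℕ.+ c ℕ.+ (c ℕ.+ l) ≡ t ℕ.+ 2 ℕ.* c ℕ.+ l
    regroup = solve-∀

-- Distance sums of a path in closed form.

pronic-suc : ∀ p → 2 ℕ.* suc p ℕ.+ p ℕ.* suc p ≡ suc p ℕ.* suc (suc p)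
pronic-suc = solve-∀

gauss : ∀ p → 2 ℕ.* ∑[ i < suc p ] toℕ i ≡ p ℕ.* suc p
gauss zero    = refl
gauss (suc p) = begin
  2 ℕ.* ∑[ i < suc p ] suc (toℕ i)          ≡⟨ cong (2 ℕ.*_) (∑-suc {suc p} toℕ) ⟩
  2 ℕ.* (suc p ℕ.+ ∑[ i < suc p ] toℕ i)    ≡⟨ ℕ.*-distribˡ-+ 2 (suc p) _ ⟩
  2 ℕ.* suc p ℕ.+ 2 ℕ.* ∑[ i < suc p ] toℕ i ≡⟨ cong (2 ℕ.* suc p ℕ.+_) (gauss p) ⟩
  2 ℕ.* suc p ℕ.+ p ℕ.* suc p               ≡⟨ pronic-suc p ⟩
  suc p ℕ.* suc (suc p)                     ∎
  where open ≡-Reasoning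

distSum-pathDist-zero : ∀ p → 2 ℕ.* distSum {suc p} pathDist zero ≡ p ℕ.* suc p
distSum-pathDist-zero p =
  trans (cong (2 ℕ.*_) (sum-cong-≗ {suc p} λ i → ℕ.∣-∣-identityʳ (toℕ i))) (gauss p)

-- Removing node zero, at distance `suc p` from the end, leaves a shorter path with end `fromℕ p`.
distSum-pathDist-fromℕ : ∀ p → 2 ℕ.* distSum {suc p} pathDist (fromℕ p) ≡ p ℕ.* suc p
distSum-pathDist-fromℕ zero    = refl
distSum-pathDist-fromℕ (suc p) = begin
  2 ℕ.* (suc (toℕ (fromℕ p)) ℕ.+ distSum pathDist (fromℕ p))
    ≡⟨ cong (λ l → 2 ℕ.* (suc l ℕ.+ distSum pathDist (fromℕ p))) (toℕ-fromℕ p) ⟩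
  2 ℕ.* (suc p ℕ.+ distSum pathDist (fromℕ p))
    ≡⟨ ℕ.*-distribˡ-+ 2 (suc p) _ ⟩
  2 ℕ.* suc p ℕ.+ 2 ℕ.* distSum pathDist (fromℕ p)
    ≡⟨ cong (2 ℕ.* suc p ℕ.+_) (distSum-pathDist-fromℕ p) ⟩
  2 ℕ.* suc p ℕ.+ p ℕ.* suc p
    ≡⟨ pronic-suc p ⟩
  suc p ℕ.* suc (suc p) ∎
  where open ≡-Reasoning

-- The double sum is twice the Wiener index `(p + 2 choose 3)` of a path with `p + 1` nodes; the
-- factor 3 clears the denominator. The induction removes node zero, whose row and column each sum
-- to `S`.
distTotal-pathDist : ∀ p → 3 ℕ.* distTotal {suc p} pathDist ≡ p ℕ.* suc p ℕ.* suc (suc p)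
distTotal-pathDist zero    = refl
distTotal-pathDist (suc p) = begin
  3 ℕ.* ((∑[ j < suc p ] suc (toℕ j)) ℕ.+ ∑[ i < suc p ] (suc (toℕ i) ℕ.+ ∑[ j < suc p ] pathDist i j))
    ≡⟨ cong (λ s → 3 ℕ.* (S ℕ.+ s)) (∑-distrib-+ {suc p} (suc ∘ toℕ) (λ i → ∑[ j < suc p ] pathDist i j)) ⟩
  3 ℕ.* (S ℕ.+ (S ℕ.+ W))
    ≡⟨ regroup S W ⟩
  3 ℕ.* (2 ℕ.* S) ℕ.+ 3 ℕ.* W
    ≡⟨ cong₂ (λ s w → 3 ℕ.* s ℕ.+ w) (gauss (suc p)) (distTotal-pathDist p) ⟩
  3 ℕ.* (suc p ℕ.* suc (suc p)) ℕ.+ p ℕ.* suc p ℕ.* suc (suc p)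
    ≡⟨ collect p ⟩
  suc p ℕ.* suc (suc p) ℕ.* suc (suc (suc p)) ∎
  where
  open ≡-Reasoning
  S = ∑[ j < suc p ] suc (toℕ j)
  W = distTotal {suc p} pathDist
  regroup : ∀ s w → 3 ℕ.* (s ℕ.+ (s ℕ.+ w)) ≡ 3 ℕ.* (2 ℕ.* s) ℕ.+ 3 ℕ.* w
  regroup = solve-∀
  collect : ∀ p → 3 ℕ.* (suc p ℕ.* suc (suc p)) ℕ.+ p ℕ.* suc p ℕ.* suc (suc p)
                ≡ suc p ℕ.* suc (suc p) ℕ.* suc (suc (suc p))
  collect = solve-∀

-- The distance sum of the double comet.

-- The term p (p + 1) and the term 6 (a + b) are moved to the left so that no subtraction occurs.
totalDist-doubleComet : ∀ p .{{_ : ℕ.NonZero p}} a b (conn : Connected (doubleCometOnPath p a b)) →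
  3 ℕ.* totalDist (doubleCometOnPath p a b) conn ℕ.+ (6 ℕ.* (a ℕ.+ b) ℕ.+ p ℕ.* (p ℕ.+ 1))
    ≡ (p ℕ.+ 1) ℕ.* (p ℕ.* (p ℕ.+ 3 ℕ.* (a ℕ.+ b)) ℕ.+ 6 ℕ.* (a ℕ.* b)) ℕ.+ 6 ℕ.* (a ℕ.* a ℕ.+ b ℕ.* b)
totalDist-doubleComet (suc q) a b conn = begin
  3 ℕ.* totalDist (doubleCometOnPath p a b) conn ℕ.+ X
    ≡⟨ cong (λ t → 3 ℕ.* t ℕ.+ X) totalDist-expansion ⟩
  3 ℕ.* (W ℕ.+ 2 ℕ.* (a ℕ.* (p ℕ.+ s₀)) ℕ.+ La
         ℕ.+ 2 ℕ.* (b ℕ.* (p ℕ.+ a ℕ.+ (s₁ ℕ.+ a ℕ.* p))) ℕ.+ Lb) ℕ.+ X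
    -- The `6 * (a + b)` of `X` is dealt out to `La` and `Lb`, and factors 2 move onto `s₀` and
    -- `s₁`, so that left sides of the earlier identities appear.
    ≡⟨ regroup W La Lb s₀ s₁ p a b ⟩
  3 ℕ.* W ℕ.+ 3 ℕ.* (a ℕ.* (2 ℕ.* p ℕ.+ 2 ℕ.* s₀)) ℕ.+ 3 ℕ.* (La ℕ.+ 2 ℕ.* a)
    ℕ.+ 3 ℕ.* (b ℕ.* (2 ℕ.* (p ℕ.+ a ℕ.+ a ℕ.* p) ℕ.+ 2 ℕ.* s₁)) ℕ.+ 3 ℕ.* (Lb ℕ.+ 2 ℕ.* b)
    ℕ.+ p ℕ.* (p ℕ.+ 1)
    ≡⟨ substitute (distTotal-pathDist q) (distSum-pathDist-zero q) (distSum-pathDist-fromℕ q)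
                  (distTotal-siblingDist a) (distTotal-siblingDist b) ⟩
  q ℕ.* p ℕ.* suc p ℕ.+ 3 ℕ.* (a ℕ.* (2 ℕ.* p ℕ.+ q ℕ.* p)) ℕ.+ 3 ℕ.* (2 ℕ.* (a ℕ.* a))
    ℕ.+ 3 ℕ.* (b ℕ.* (2 ℕ.* (p ℕ.+ a ℕ.+ a ℕ.* p) ℕ.+ q ℕ.* p)) ℕ.+ 3 ℕ.* (2 ℕ.* (b ℕ.* b))
    ℕ.+ p ℕ.* (p ℕ.+ 1)
    -- Adding `p * (p + 1)` to `q * p * suc p` gives `p * p * (p + 1)`, which removes `p - 1` from
    -- the formula.
    ≡⟨ collect q a b ⟩
  (p ℕ.+ 1) ℕ.* (p ℕ.* (p ℕ.+ 3 ℕ.* (a ℕ.+ b)) ℕ.+ 6 ℕ.* (a ℕ.* b)) ℕ.+ 6 ℕ.* (a ℕ.* a ℕ.+ b ℕ.* b) ∎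
  where
  open ≡-Reasoning
  p = suc q
  X = 6 ℕ.* (a ℕ.+ b) ℕ.+ p ℕ.* (p ℕ.+ 1)
  P = pathGraph p
  G = attach P zero a
  D = attachDist P zero a pathDist
  end = fromℕ q ↑ˡ a
  W = distTotal {p} pathDist
  La = distTotal (siblingDist {a})
  Lb = distTotal (siblingDist {b})
  s₀ = distSum {p} pathDist zero
  s₁ = distSum {p} pathDist (fromℕ q)

  D-isDistance : IsDistance G D
  D-isDistance = attachDist-isDistance P zero a pathDist (pathDist-isDistance p)

  distSum-end : distSum D end ≡ s₁ ℕ.+ a ℕ.* p
  distSum-end = trans (distSum-attachDist P zero a pathDist (fromℕ q))
    -- The far end is `q` edges from node zero, hence `suc q`, that is `p`, from each of the first
    -- `a` leaves.
    (cong (λ l → s₁ ℕ.+ a ℕ.* suc l) (toℕ-fromℕ q))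

  totalDist-expansion : totalDist (doubleCometOnPath p a b) conn
    ≡ W ℕ.+ 2 ℕ.* (a ℕ.* (p ℕ.+ s₀)) ℕ.+ La
      ℕ.+ 2 ℕ.* (b ℕ.* (p ℕ.+ a ℕ.+ (s₁ ℕ.+ a ℕ.* p))) ℕ.+ Lb
  totalDist-expansion = begin
    totalDist (attach G end b) conn
      ≡⟨ totalDist≡ (attachDist-isDistance G end b D D-isDistance) conn ⟩
    distTotal (attachDist G end b D)
      ≡⟨ distTotal-attachDist G end b D (IsDistance.D-sym D-isDistance) ⟩
    distTotal D ℕ.+ 2 ℕ.* (b ℕ.* (p ℕ.+ a ℕ.+ distSum D end)) ℕ.+ Lb
      ≡⟨ cong₂ (λ t s → t ℕ.+ 2 ℕ.* (b ℕ.* (p ℕ.+ a ℕ.+ s)) ℕ.+ Lb)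
               (distTotal-attachDist P zero a pathDist (IsDistance.D-sym (pathDist-isDistance p)))
               distSum-end ⟩
    W ℕ.+ 2 ℕ.* (a ℕ.* (p ℕ.+ s₀)) ℕ.+ La ℕ.+ 2 ℕ.* (b ℕ.* (p ℕ.+ a ℕ.+ (s₁ ℕ.+ a ℕ.* p))) ℕ.+ Lb ∎

  regroup : ∀ W La Lb s₀ s₁ p a b →
    3 ℕ.* (W ℕ.+ 2 ℕ.* (a ℕ.* (p ℕ.+ s₀)) ℕ.+ La
           ℕ.+ 2 ℕ.* (b ℕ.* (p ℕ.+ a ℕ.+ (s₁ ℕ.+ a ℕ.* p))) ℕ.+ Lb)
      ℕ.+ (6 ℕ.* (a ℕ.+ b) ℕ.+ p ℕ.* (p ℕ.+ 1))
    ≡ 3 ℕ.* W ℕ.+ 3 ℕ.* (a ℕ.* (2 ℕ.* p ℕ.+ 2 ℕ.* s₀)) ℕ.+ 3 ℕ.* (La ℕ.+ 2 ℕ.* a)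
      ℕ.+ 3 ℕ.* (b ℕ.* (2 ℕ.* (p ℕ.+ a ℕ.+ a ℕ.* p) ℕ.+ 2 ℕ.* s₁)) ℕ.+ 3 ℕ.* (Lb ℕ.+ 2 ℕ.* b)
      ℕ.+ p ℕ.* (p ℕ.+ 1)
  regroup = solve-∀

  -- A congruence in five places: as both sides of each equation are variables, matching on `refl`
  -- replaces all five sums at once.
  substitute : ∀ {w w′ t t′ u u′ k k′ l l′} → w ≡ w′ → t ≡ t′ → u ≡ u′ → k ≡ k′ → l ≡ l′ →
    w ℕ.+ 3 ℕ.* (a ℕ.* (2 ℕ.* p ℕ.+ t)) ℕ.+ 3 ℕ.* k
      ℕ.+ 3 ℕ.* (b ℕ.* (2 ℕ.* (p ℕ.+ a ℕ.+ a ℕ.* p) ℕ.+ u)) ℕ.+ 3 ℕ.* l ℕ.+ p ℕ.* (p ℕ.+ 1)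
    ≡ w′ ℕ.+ 3 ℕ.* (a ℕ.* (2 ℕ.* p ℕ.+ t′)) ℕ.+ 3 ℕ.* k′
      ℕ.+ 3 ℕ.* (b ℕ.* (2 ℕ.* (p ℕ.+ a ℕ.+ a ℕ.* p) ℕ.+ u′)) ℕ.+ 3 ℕ.* l′ ℕ.+ p ℕ.* (p ℕ.+ 1)
  substitute refl refl refl refl refl = refl

  collect : ∀ q a b →
    q ℕ.* suc q ℕ.* suc (suc q) ℕ.+ 3 ℕ.* (a ℕ.* (2 ℕ.* suc q ℕ.+ q ℕ.* suc q)) ℕ.+ 3 ℕ.* (2 ℕ.* (a ℕ.* a))
      ℕ.+ 3 ℕ.* (b ℕ.* (2 ℕ.* (suc q ℕ.+ a ℕ.+ a ℕ.* suc q) ℕ.+ q ℕ.* suc q)) ℕ.+ 3 ℕ.* (2 ℕ.* (b ℕ.* b))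
      ℕ.+ suc q ℕ.* (suc q ℕ.+ 1)
    ≡ (suc q ℕ.+ 1) ℕ.* (suc q ℕ.* (suc q ℕ.+ 3 ℕ.* (a ℕ.+ b)) ℕ.+ 6 ℕ.* (a ℕ.* b))
      ℕ.+ 6 ℕ.* (a ℕ.* a ℕ.+ b ℕ.* b)
  collect = solve-∀

-- Passage to the integers and the stated denominator.

denominator≡3* : ∀ n p a b T → n ≡ p ℕ.+ (a ℕ.+ b) →
  3 ℕ.* T ℕ.+ (6 ℕ.* (a ℕ.+ b) ℕ.+ p ℕ.* (p ℕ.+ 1))
    ≡ (p ℕ.+ 1) ℕ.* (p ℕ.* (p ℕ.+ 3 ℕ.* (a ℕ.+ b)) ℕ.+ 6 ℕ.* (a ℕ.* b)) ℕ.+ 6 ℕ.* (a ℕ.* a ℕ.+ b ℕ.* b) →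
  let N = + n ; A = + a ; B = + b in
  (N - A - B + + 1) * ((N - A - B) * (N - A + + 2 * B - + 1) + + 3 * A * (N - A + B))
    + + 6 * (B * (B - + 1) + A * (A - + 1))
  ≡ + 3 * + T
denominator≡3* n p a b T refl eq = begin
  (N - A - B + + 1) * ((N - A - B) * (N - A + + 2 * B - + 1) + + 3 * A * (N - A + B))
    + + 6 * (B * (B - + 1) + A * (A - + 1))
    -- After the match on `refl`, `N` computes to `P + (A + B)`, so a ring identity remains; it
    -- subtracts the terms that were moved to the left.
    ≡⟨ expand P A B ⟩
  (P + + 1) * (P * (P + + 3 * (A + B)) + + 6 * (A * B)) + + 6 * (A * A + B * B)
    - (+ 6 * (A + B) + P * (P + + 1))
    ≡⟨ cong (_- (+ 6 * (A + B) + P * (P + + 1))) eqℤ ⟨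
  + 3 * + T + (+ 6 * (A + B) + P * (P + + 1)) - (+ 6 * (A + B) + P * (P + + 1))
    ≡⟨ cancel (+ T) P A B ⟩
  + 3 * + T ∎
  where
  open ≡-Reasoning
  N = + n
  P = + p
  A = + a
  B = + b

  eqℤ : + 3 * + T + (+ 6 * (A + B) + P * (P + + 1))
      ≡ (P + + 1) * (P * (P + + 3 * (A + B)) + + 6 * (A * B)) + + 6 * (A * A + B * B)
  -- Products of casts become casts of products, inner ones before those containing them; sums of
  -- casts compute by themselves.
  eqℤ rewrite sym (ℤ.pos-* a b) | sym (ℤ.pos-* a a) | sym (ℤ.pos-* b b)
            | sym (ℤ.pos-* 3 T) | sym (ℤ.pos-* 6 (a ℕ.+ b)) | sym (ℤ.pos-* p (p ℕ.+ 1))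
            | sym (ℤ.pos-* 3 (a ℕ.+ b)) | sym (ℤ.pos-* 6 (a ℕ.* b))
            | sym (ℤ.pos-* 6 (a ℕ.* a ℕ.+ b ℕ.* b))
            | sym (ℤ.pos-* p (p ℕ.+ 3 ℕ.* (a ℕ.+ b)))
            | sym (ℤ.pos-* (p ℕ.+ 1) (p ℕ.* (p ℕ.+ 3 ℕ.* (a ℕ.+ b)) ℕ.+ 6 ℕ.* (a ℕ.* b)))
            = cong +_ eq

  expand : ∀ P A B →
    (P + (A + B) - A - B + + 1)
      * ((P + (A + B) - A - B) * (P + (A + B) - A + + 2 * B - + 1) + + 3 * A * (P + (A + B) - A + B))
      + + 6 * (B * (B - + 1) + A * (A - + 1))
    ≡ (P + + 1) * (P * (P + + 3 * (A + B)) + + 6 * (A * B)) + + 6 * (A * A + B * B)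
      - (+ 6 * (A + B) + P * (P + + 1))
  expand = ℤ-solve-∀

  cancel : ∀ T P A B →
    + 3 * T + (+ 6 * (A + B) + P * (P + + 1)) - (+ 6 * (A + B) + P * (P + + 1)) ≡ + 3 * T
  cancel = ℤ-solve-∀

-- Rational quotients and the final assembly.

-- Moves products to unnormalised fractions, where equality is cross-multiplication and no gcd
-- intervenes.
fromℚᵘ-homo-* : ∀ p q → ℚ.fromℚᵘ p ℚ.* ℚ.fromℚᵘ q ≡ ℚ.fromℚᵘ (p ℚᵘ.* q)
fromℚᵘ-homo-* p q = ℚ.toℚᵘ-injective (begin
  ℚ.toℚᵘ (ℚ.fromℚᵘ p ℚ.* ℚ.fromℚᵘ q)            ≈⟨ ℚ.toℚᵘ-homo-* (ℚ.fromℚᵘ p) (ℚ.fromℚᵘ q) ⟩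
  ℚ.toℚᵘ (ℚ.fromℚᵘ p) ℚᵘ.* ℚ.toℚᵘ (ℚ.fromℚᵘ q)  ≈⟨ ℚᵘ.*-cong (ℚ.toℚᵘ-fromℚᵘ p) (ℚ.toℚᵘ-fromℚᵘ q) ⟩
  p ℚᵘ.* q                                      ≈⟨ ℚ.toℚᵘ-fromℚᵘ (p ℚᵘ.* q) ⟨
  ℚ.toℚᵘ (ℚ.fromℚᵘ (p ℚᵘ.* q))                  ∎)
  where open ℚᵘ.≃-Reasoning

-- Expands a fraction by `k`: multiplying `x / T` by `q`, which is `k * T`, gives `k * x`, and `q`
-- is then divided out. A separate `d` admits a denominator that equals `+ k * + T` only by a proof.
/≡÷ : ∀ x d k T .{{_ : ℕ.NonZero k}} .{{_ : ℕ.NonZero T}} → d ≡ + k * + T →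
      Σ (NonZero (d / 1)) λ nonZero → x / T ≡ _÷_ ((+ k * x) / 1) (d / 1) {{nonZero}}
/≡÷ x _ k@(suc _) T@(suc t) refl = nonZero , (begin
  x / T                      ≡⟨ ℚ.*-identityʳ (x / T) ⟨
  x / T ℚ.* ℚ.1ℚ             ≡⟨ cong (x / T ℚ.*_) (ℚ.*-inverseʳ q) ⟨
  x / T ℚ.* (q ℚ.* ℚ.1/ q)   ≡⟨ ℚ.*-assoc (x / T) q (ℚ.1/ q) ⟨
  (x / T ℚ.* q) ℚ.* ℚ.1/ q   ≡⟨ cong (ℚ._* ℚ.1/ q) cleared ⟩
  ((+ k * x) / 1) ℚ.* ℚ.1/ q ∎)
  where
  open ≡-Reasoning
  q = (+ k * + T) / 1

  instance
    nonZero : NonZero q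
    nonZero = ℚ.pos⇒nonZero q {{ℚ.normalize-pos (k ℕ.* T) 1}}

  swap-factors : ∀ x k t → x * (k * t) * + 1 ≡ k * x * (t * + 1)
  swap-factors = ℤ-solve-∀

  cleared : x / T ℚ.* q ≡ (+ k * x) / 1
  -- `mkℚᵘ` stores the denominator minus one, so `t` and `0` stand for `T` and 1.
  cleared = trans (fromℚᵘ-homo-* (mkℚᵘ x t) (mkℚᵘ (+ k * + T) 0))
    (ℚ.fromℚᵘ-cong {mkℚᵘ x t ℚᵘ.* mkℚᵘ (+ k * + T) 0} {mkℚᵘ (+ k * x) 0}
      (*≡* (swap-factors x (+ k) (+ T))))

lemma2p3p1 : ∀ (n a b : ℕ) → 1 ≤ a → 1 ≤ b → (n≥a+b+2 : a ℕ.+ b ℕ.+ 2 ≤ n) →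
    let N = + n
        A = + a
        B = + b
        numerator   = (+ 3 * (N - + 1)) / 1
        denominator = ((N - A - B + + 1)
                         * ((N - A - B) * (N - A + + 2 * B - + 1) + + 3 * A * (N - A + B))
                       + + 6 * (B * (B - + 1) + A * (A - + 1))) / 1
    in Σ (NonZero denominator) λ nonZero →
         agglomeration (DC n a b n≥a+b+2) (DC-connected n a b n≥a+b+2) (2≤DC-order n a b n≥a+b+2)
           ≡ _÷_ numerator denominator {{nonZero}}
lemma2p3p1 n a b _ _ h = proj₁ quotient , trans
  -- Only the numerator is rewritten from the order of the graph to `n`; `T` stays fixed.
  (cong (λ m → _/_ (+ m - + 1) T {{T-nonZero}}) (DC-order n a b h))
  (proj₂ quotient)
  where
  p = n ℕ.∸ (a ℕ.+ b)
  conn = DC-connected n a b h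
  T = totalDist (DC n a b h) conn
  T-nonZero = totalDist-nonZero (DC n a b h) conn (2≤DC-order n a b h)

  n≡p+a+b : n ≡ p ℕ.+ (a ℕ.+ b)
  n≡p+a+b = sym (ℕ.m∸n+n≡m (ℕ.≤-trans (ℕ.m≤m+n (a ℕ.+ b) 2) h))

  quotient = /≡÷ (+ n - + 1) _ 3 T {{_}} {{T-nonZero}}
    (denominator≡3* n p a b T n≡p+a+b
      (totalDist-doubleComet p {{pathPart-nonZero n a b h}} a b conn))
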